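{- Let $K$ be a field of characteristic $0$ and let $f(x)\in K[x,x^{ -1}]$ be a non-constant Laurent polynomial. Then there exists a positive integer $N$ such that every element $c\in K$ can be written as $c=\epsilon_1 f(a_1)+\cdots+\epsilon_N f(a_N)$ with $a_1,\dots,a_N\in K^*$ and $\epsilon_1,\dots,\epsilon_N\in\{1,-1\}$. In particular, for $K=\mathbb{Q}$, $f$ satisfies the EWP.
   Context: A rational function $f\in\mathbb{Q}(x)$ satisfies the EWP if for some $N\ge1$ every rational number can be written as $\epsilon_1f(a_1)+\cdots+\epsilon_Nf(a_N)$ with $\epsilon_i\in\{1,-1\}$ and $a_i\in\mathbb{Q}$ not poles of $f$. -}

module Defs where

open import Level using (Level; _⊔_)
open import Algebra.Apartness using (HeytingField; HeytingCommutativeRing)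
open import Algebra.Bundles using (CommutativeRing; Semiring)
import Algebra.Apartness.Properties.HeytingCommutativeRing as HeytingProperties
import Algebra.Definitions.RawSemiring as RawSemiring
open import Data.Fin.Base using (Fin; toℕ)
open import Data.Integer.Base using (ℤ; +_; -[1+_]; ∣_∣; _⊖_)
open import Data.List.Base using (List; []; _∷_; _++_; map; replicate; tabulate)
open import Data.Nat.Base as ℕ using (ℕ; zero; suc)
open import Data.Product.Base using (∃-syntax; Σ-syntax; _×_; _,_; proj₁; proj₂)
open import Data.Rational.Base using (ℚ)
open import Data.Rational.Properties using () renaming (heytingField to ℚ-field)
open import Data.Sign.Base using (Sign)
open import Relation.Binary.PropositionalEquality.Core using (_≡_)

-- Fields are Heyting fields: `x # y` is the constructive reading of x ≠ y.
-- Every field with decidable equality is one, with `#` the negation of `≈`.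

module _ {c ℓ₁ ℓ₂ : Level} (K : HeytingField c ℓ₁ ℓ₂) where

  open HeytingField K
    using (Carrier; _≈_; _#_; _+_; _*_; -_; 0#; 1#; refl; #⇒invertible
          ; heytingCommutativeRing)
  open HeytingProperties heytingCommutativeRing using (1#0)
  private
    open module S = RawSemiring
      (Semiring.rawSemiring (CommutativeRing.semiring
        (HeytingCommutativeRing.commutativeRing heytingCommutativeRing)))
      using (sum; _^_)

  CharacteristicZero : Set ℓ₂
  CharacteristicZero = ∀ (n : ℕ) → (suc n S.× 1#) # 0#

  Nonzero : Set (c ⊔ ℓ₂)
  Nonzero = ∃[ a ] a # 0#

  -- `#⇒invertible` inverts a - 0#, which is ≈ a.
  inverse : Nonzero → Carrier
  inverse (a , a#0) = proj₁ (#⇒invertible a#0)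

  _^ℤ_ : Nonzero → ℤ → Carrier
  a ^ℤ (+ n)    = proj₁ a ^ n
  a ^ℤ -[1+ n ] = inverse a ^ suc n

  ⟦_⟧ˢ : Sign → Carrier
  ⟦ Sign.+ ⟧ˢ = 1#
  ⟦ Sign.- ⟧ˢ = - 1#

  signedSum : ∀ {N} → (Fin N → Sign) → (Fin N → Carrier) → Carrier
  signedSum ε v = sum (λ i → ⟦ ε i ⟧ˢ * v i)

  -- Finitely supported coefficient families indexed by ℤ.  `bound` is any
  -- bound on the absolute values of the exponents, not necessarily the least.
  record LaurentPolynomial : Set (c ⊔ ℓ₁) where
    field
      coeff   : ℤ → Carrier
      bound   : ℕ
      support : ∀ i → bound ℕ.< ∣ i ∣ → coeff i ≈ 0#

  open LaurentPolynomial

  constant : Carrier → LaurentPolynomial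
  constant x .coeff (+ zero)      = x
  constant x .coeff (+ (suc _))   = 0#
  constant x .coeff -[1+ _ ]      = 0#
  constant x .bound               = 0
  constant x .support (+ zero)    ()
  constant x .support (+ (suc _)) _ = refl
  constant x .support -[1+ _ ]    _ = refl

  _#ᴸ_ : LaurentPolynomial → LaurentPolynomial → Set ℓ₂
  f #ᴸ g = ∃[ i ] coeff f i # coeff g i

  NonConstant : LaurentPolynomial → Set (c ⊔ ℓ₂)
  NonConstant f = ∀ x → f #ᴸ constant x

  evalᴸ : LaurentPolynomial → Nonzero → Carrier
  evalᴸ f a = sum {suc (bound f ℕ.+ bound f)} λ j →
    let i = toℕ j ⊖ bound f in coeff f i * (a ^ℤ i)

  -- Coefficient lists, constant term first; trailing zeros are allowed, so
  -- equality of polynomials is `_≈ᴾ_`.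
  Polynomial : Set c
  Polynomial = List Carrier

  coeffᴾ : Polynomial → ℕ → Carrier
  coeffᴾ []      _       = 0#
  coeffᴾ (x ∷ p) zero    = x
  coeffᴾ (x ∷ p) (suc n) = coeffᴾ p n

  _≈ᴾ_ : Polynomial → Polynomial → Set ℓ₁
  p ≈ᴾ q = ∀ n → coeffᴾ p n ≈ coeffᴾ q n

  _+ᴾ_ : Polynomial → Polynomial → Polynomial
  []      +ᴾ q       = q
  (x ∷ p) +ᴾ []      = x ∷ p
  (x ∷ p) +ᴾ (y ∷ q) = (x + y) ∷ (p +ᴾ q)

  _*ᴾ_ : Polynomial → Polynomial → Polynomial
  []      *ᴾ q = []
  (x ∷ p) *ᴾ q = map (x *_) q +ᴾ (0# ∷ (p *ᴾ q))

  evalᴾ : Polynomial → Carrier → Carrier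
  evalᴾ []      a = 0#
  evalᴾ (x ∷ p) a = x + a * evalᴾ p a

  record RationalFunction : Set (c ⊔ ℓ₂) where
    field
      num   : Polynomial
      den   : Polynomial
      den#0 : ∃[ n ] coeffᴾ den n # 0#

  open RationalFunction

  -- Fractions need not be reduced; `_≃_` is equality in K(x).
  _≃_ : RationalFunction → RationalFunction → Set ℓ₁
  f ≃ g = (num f *ᴾ den g) ≈ᴾ (num g *ᴾ den f)

  -- a is not a pole of f when f is equal in K(x) to some fraction whose
  -- denominator does not vanish at a.
  NotPole : RationalFunction → Carrier → Set (c ⊔ ℓ₁ ⊔ ℓ₂)
  NotPole f a = ∃[ g ] (g ≃ f × evalᴾ (den g) a # 0#)

  value : (f : RationalFunction) (a : Carrier) → NotPole f a → Carrier
  value f a (g , _ , d#0) = evalᴾ (num g) a * inverse (evalᴾ (den g) a , d#0)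

  monomial : ℕ → Polynomial
  monomial d = replicate d 0# ++ 1# ∷ []

  monomial#0 : ∀ d → coeffᴾ (monomial d) d # 0#
  monomial#0 zero    = 1#0
  monomial#0 (suc d) = monomial#0 d

  -- The inclusion K[x,x⁻¹] ⊆ K(x): with d = bound f, f = (xᵈ f) / xᵈ.
  toRationalFunction : LaurentPolynomial → RationalFunction
  toRationalFunction f .num =
    tabulate {n = suc (bound f ℕ.+ bound f)} (λ j → coeff f (toℕ j ⊖ bound f))
  toRationalFunction f .den   = monomial (bound f)
  toRationalFunction f .den#0 = bound f , monomial#0 (bound f)

EWP : RationalFunction ℚ-field → Set
EWP f = Σ[ N ∈ ℕ ] (1 ℕ.≤ N × (∀ (x : ℚ) →
  Σ[ ε ∈ (Fin N → Sign) ] Σ[ a ∈ (Fin N → ℚ) ]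
  Σ[ a-notPole ∈ (∀ i → NotPole ℚ-field f (a i)) ]
    x ≡ signedSum ℚ-field ε (λ i → value ℚ-field f (a i) (a-notPole i))))

{-# OPTIONS --safe #-}
module Submission where

-- Applying h ↦ q h(m + 1) − p h(m) to h(m) = f(2ᵐa) kills the monomial xⁱ when
-- p/q = 2ⁱ.  Killing all exponents of f but one nonzero exponent shows that
-- κ bᵈ, for some d ≥ 1 and κ ≠ 0, is a signed sum of boundedly many values of
-- f for every b ≠ 0 (replace b by b⁻¹ if the exponent is negative).  By the
-- binomial theorem h(m) = κ (2ᵐu + 1)ᵈ is again a combination of geometric
-- sequences in m; killing all powers of u but the first makes κ′u a signed
-- sum for every u.  The points 2ᵐu + 1 have to be nonzero, which holds for all
-- the m in question either for u or for - u.

open import Defs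
open import Algebra.Apartness using (HeytingField; HeytingCommutativeRing)
open import Algebra.Bundles using (CommutativeRing)
import Algebra.Apartness.Properties.HeytingCommutativeRing as HeytingProperties
import Algebra.Properties.AbelianGroup as AbelianGroupProperties
import Algebra.Properties.CommutativeSemiring.Binomial as Binomial
import Algebra.Properties.CommutativeSemiring.Exp as Exp
import Algebra.Properties.Ring as RingProperties
import Algebra.Properties.Semiring.Mult as Mult
import Algebra.Properties.Semiring.Sum as SemiringSum
import Algebra.Solver.Ring.NaturalCoefficients.Default as Solver
open import Data.Fin.Base using (Fin; zero; suc; toℕ; fromℕ<; punchIn)
open import Data.Fin.Properties using (toℕ-injective; toℕ-fromℕ<; punchInᵢ≢i)
open import Data.Integer.Base as ℤ using (+_; -[1+_]; _⊖_)
import Data.Integer.Properties as ℤ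
open import Data.List.Base using (List; []; _∷_; length; tabulate)
open import Data.List.Membership.Propositional using (_∈_)
open import Data.List.Membership.Propositional.Properties using (∈-tabulate⁺)
open import Data.List.Relation.Unary.All using (All; []; _∷_)
import Data.List.Relation.Unary.All.Properties as All
open import Data.List.Relation.Unary.Any using (here; there)
open import Data.Nat.Base as ℕ using (ℕ; zero; suc; _≤_; _<_; z≤n; s≤s; _∸_)
open import Data.Nat.Combinatorics using (_C_; nC1≡n)
import Data.Nat.Properties as ℕ
open import Data.Product.Base using (Σ-syntax; _×_; _,_; proj₁; proj₂)
open import Data.Rational.Base using (1ℚ; Positive; NonNegative)
import Data.Rational.Properties as ℚ
open import Data.Rational.Properties using () renaming (heytingField to ℚ-field)
open import Data.Sign.Base using (Sign; opposite)
open import Data.Sum.Base as Sum using (_⊎_; inj₁; inj₂; swap)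
open import Data.Vec.Functional as Vector using ()
open import Function.Base using (_∘_)
open import Level using (Level; _⊔_)
open import Relation.Binary.Definitions using (tri<; tri≈; tri>)
open import Relation.Binary.PropositionalEquality.Core as ≡ using (_≡_; _≢_)
import Relation.Binary.Reasoning.Setoid as ≈-Reasoning
open import Relation.Nullary using (yes; no; contradiction)

-- Finite case distinctions and powers of 2.

-- A finite search: either some `m < n` yields `Q`, or every one yields `P m`. This replaces a
-- decision by excluded middle, since apartness in a Heyting field need not be decidable.
∀<-⊎ : ∀ {p q} {P : ℕ → Set p} {Q : Set q} → (∀ m → P m ⊎ Q) →
       ∀ n → (∀ m → m < n → P m) ⊎ Q
∀<-⊎ pq zero = inj₁ λ _ ()
∀<-⊎ pq (suc n) with pq n | ∀<-⊎ pq n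
... | inj₂ q | _ = inj₂ q
... | inj₁ _ | inj₂ q = inj₂ q
... | inj₁ p | inj₁ ps = inj₁ λ m m<1+n →
  Sum.[ ps m , (λ { ≡.refl → p }) ]′ (ℕ.m≤n⇒m<n∨m≡n (ℕ.≤-pred m<1+n))

2^-injective : ∀ {m n} → 2 ℕ.^ m ≡ 2 ℕ.^ n → m ≡ n
2^-injective {m} {n} eq with ℕ.<-cmp m n
... | tri< m<n _ _ = contradiction eq (ℕ.<⇒≢ (ℕ.^-monoʳ-< 2 ℕ.≤-refl m<n))
... | tri≈ _ m≡n _ = m≡n
... | tri> _ _ n<m = contradiction (≡.sym eq) (ℕ.<⇒≢ (ℕ.^-monoʳ-< 2 ℕ.≤-refl n<m))

module _ {c ℓ₁ ℓ₂ : Level} (K : HeytingField c ℓ₁ ℓ₂) where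

  open HeytingField K
    using (_#_; #⇒invertible; #-cotrans; #-irrefl; heytingCommutativeRing)
  open HeytingProperties heytingCommutativeRing
    using (invertibleʳ⇒#; x-0≈x; 1#0; x#0y#0→xy#0; #-congʳ)
  open CommutativeRing (HeytingCommutativeRing.commutativeRing heytingCommutativeRing)
    hiding (zero)
  open RingProperties ring
    using (-‿distribˡ-*; -‿distribʳ-*; -1*x≈-x; -‿+-comm; -‿involutive; -0#≈0#)
  open AbelianGroupProperties +-abelianGroup using (⁻¹-anti-homo‿-)
  open Mult semiring hiding (_×_)
  open SemiringSum semiring
    using (sum; sum-cong-≋; sum-remove; sum-replicate-zero; ∑-distrib-+
          ; *-distribˡ-sum; *-distribʳ-sum)
  open Exp commutativeSemiring
    using (_^_; ^-congˡ; ^-homo-*; ^-assocʳ; ^-distrib-*)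
  open Solver commutativeSemiring using (solve; _:=_; _:+_; _:*_; con)
  open ≈-Reasoning setoid
  open LaurentPolynomial

  -- Natural multiples, inverses and powers in a Heyting field.

  infixr 8 _·_
  _·_ : ℕ → Carrier → Carrier
  _·_ = Mult._×_ semiring

  ι : ℕ → Carrier
  ι n = n · 1#

  ·-ι : ∀ n x → n · x ≈ ι n * x
  ·-ι n x = sym (trans (×-assoc-* n 1# x) (×-congʳ n (*-identityˡ x)))

  ι-^ : ∀ m n → ι (m ℕ.^ n) ≈ ι m ^ n
  ι-^ m zero    = ×-homo-1 1#
  ι-^ m (suc n) = trans (×1-homo-* m (m ℕ.^ n)) (*-congˡ (ι-^ m n))

  -- Points such as 2ᵐa are shown to be nonzero by exhibiting an inverse.
  unit⇒#0 : ∀ {x y} → x * y ≈ 1# → x # 0#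
  unit⇒#0 xy≈1 = invertibleʳ⇒# (_ , trans (*-congʳ (x-0≈x _)) xy≈1)

  *-inverse : (a : Nonzero K) → proj₁ a * inverse K a ≈ 1#
  *-inverse (a , a#0) =
    trans (*-congʳ (sym (x-0≈x a))) (proj₂ (proj₂ (#⇒invertible a#0)))

  inverse-unique : ∀ {x y z} → x * y ≈ 1# → x * z ≈ 1# → y ≈ z
  inverse-unique {x} {y} {z} xy≈1 xz≈1 = begin
    y            ≈⟨ *-identityʳ y ⟨
    y * 1#       ≈⟨ *-congˡ xz≈1 ⟨
    y * (x * z)  ≈⟨ solve 3 (λ x y z → y :* (x :* z) := x :* y :* z) refl x y z ⟩
    x * y * z    ≈⟨ *-congʳ xy≈1 ⟩
    1# * z       ≈⟨ *-identityˡ z ⟩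
    z            ∎

  inverse-* : ∀ {x x′ y y′} → x * x′ ≈ 1# → y * y′ ≈ 1# → (x * y) * (x′ * y′) ≈ 1#
  inverse-* {x} {x′} {y} {y′} p q = begin
    (x * y) * (x′ * y′)
      ≈⟨ solve 4 (λ x x′ y y′ → (x :* y) :* (x′ :* y′) := (x :* x′) :* (y :* y′))
           refl x x′ y y′ ⟩
    (x * x′) * (y * y′)  ≈⟨ *-cong p q ⟩
    1# * 1#              ≈⟨ *-identityˡ 1# ⟩
    1#                   ∎

  1^n≈1 : ∀ n → 1# ^ n ≈ 1#
  1^n≈1 zero    = refl
  1^n≈1 (suc n) = trans (*-identityˡ _) (1^n≈1 n)

  inverse-^ : ∀ {x y} n → x * y ≈ 1# → x ^ n * y ^ n ≈ 1#
  inverse-^ {x} {y} n xy≈1 = begin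
    x ^ n * y ^ n  ≈⟨ ^-distrib-* x y n ⟨
    (x * y) ^ n    ≈⟨ ^-congˡ n xy≈1 ⟩
    1# ^ n         ≈⟨ 1^n≈1 n ⟩
    1#             ∎

  ^-cancel : ∀ {x y} n k → x * y ≈ 1# → x ^ (n ℕ.+ k) * y ^ n ≈ x ^ k
  ^-cancel {x} {y} n k xy≈1 = begin
    x ^ (n ℕ.+ k) * y ^ n    ≈⟨ *-congʳ (^-homo-* x n k) ⟩
    x ^ n * x ^ k * y ^ n    ≈⟨ solve 3 (λ a b c → a :* b :* c := a :* c :* b)
                                  refl (x ^ n) (x ^ k) (y ^ n) ⟩
    x ^ n * y ^ n * x ^ k    ≈⟨ *-congʳ (inverse-^ n xy≈1) ⟩
    1# * x ^ k               ≈⟨ *-identityˡ _ ⟩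
    x ^ k                    ∎

  -- The inverse of `y` is `x` times the inverse of `x * y`.
  *#0⇒#0ʳ : ∀ {x y} → x * y # 0# → y # 0#
  *#0⇒#0ʳ {x} {y} xy#0 = unit⇒#0 (begin
    y * (x * z)  ≈⟨ solve 3 (λ x y z → y :* (x :* z) := x :* y :* z) refl x y z ⟩
    x * y * z    ≈⟨ *-inverse (x * y , xy#0) ⟩
    1#           ∎)
    where z = inverse K (x * y , xy#0)

  -- A Heyting field is a local ring. Cotransitivity puts `y` between `x + y` and `0#`: either
  -- `y # 0#`, or `x + y # y`, and then the difference `x + y - y`, which is `x`, is invertible.
  +#0⇒#0⊎#0 : ∀ {x y} → x + y # 0# → x # 0# ⊎ y # 0#
  +#0⇒#0⊎#0 {x} {y} x+y#0 with #-cotrans x+y#0 y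
  ... | inj₂ y#0 = inj₂ y#0
  ... | inj₁ x+y#y with #⇒invertible x+y#y
  ...   | z , _ , xyz≈1 = inj₁ (unit⇒#0 {y = z} (begin
    x * z              ≈⟨ *-congʳ (+-identityʳ x) ⟨
    (x + 0#) * z       ≈⟨ *-congʳ (+-congˡ (-‿inverseʳ y)) ⟨
    (x + (y - y)) * z  ≈⟨ *-congʳ (+-assoc x y (- y)) ⟨
    (x + y - y) * z    ≈⟨ xyz≈1 ⟩
    1#                 ∎))

  -- Difference operators on combinations of geometric sequences.

  -- The operator h ↦ (∏ₚ (qS − p)) h (0), S being the shift.  It multiplies
  -- the geometric sequence rᵐ by ∏ₚ (qr − p).
  annihilate : ℕ → List ℕ → (ℕ → Carrier) → Carrier
  annihilate q []       h = h 0
  annihilate q (p ∷ ps) h = annihilate q ps λ m → q · h (suc m) + - (p · h m)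

  rootProduct : List ℕ → Carrier → Carrier
  rootProduct []       x = 1#
  rootProduct (p ∷ ps) x = (x + - ι p) * rootProduct ps x

  rootProduct-cong : ∀ ps {x y} → x ≈ y → rootProduct ps x ≈ rootProduct ps y
  rootProduct-cong []       x≈y = refl
  rootProduct-cong (p ∷ ps) x≈y = *-cong (+-congʳ x≈y) (rootProduct-cong ps x≈y)

  rootProduct-root : ∀ {p ps} → p ∈ ps → rootProduct ps (ι p) ≈ 0#
  rootProduct-root {p} (here ≡.refl) = trans (*-congʳ (-‿inverseʳ (ι p))) (zeroˡ _)
  rootProduct-root (there p∈ps) = trans (*-congˡ (rootProduct-root p∈ps)) (zeroʳ _)

  -- Induction on `ps`: one factor qS - p keeps the ratios `r j` and multiplies `b j` by
  -- `ι q * r j + - ι p`, so the new sequence is of the same form.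
  annihilate-geometric : ∀ q ps {n} (b r : Fin n → Carrier) {h} →
    (∀ m → h m ≈ sum λ j → b j * r j ^ m) →
    annihilate q ps h ≈ sum λ j → b j * rootProduct ps (ι q * r j)
  annihilate-geometric q []       b r eq = eq 0
  annihilate-geometric q (p ∷ ps) {n} b r {h} eq = trans
    (annihilate-geometric q ps (λ j → b j * (ι q * r j + - ι p)) r step)
    (sum-cong-≋ {n} λ j → *-assoc (b j) (ι q * r j + - ι p) (rootProduct ps (ι q * r j)))
    where
    step : ∀ m → q · h (suc m) + - (p · h m) ≈
                 sum λ j → b j * (ι q * r j + - ι p) * r j ^ m
    step m = begin
      q · h (suc m) + - (p · h m)
        ≈⟨ +-cong (·-ι q _) (trans (-‿cong (·-ι p _)) (-‿distribˡ-* _ _)) ⟩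
      ι q * h (suc m) + - ι p * h m
        ≈⟨ +-cong (*-congˡ (eq (suc m))) (*-congˡ (eq m)) ⟩
      ι q * sum (λ j → b j * r j ^ suc m) + - ι p * sum (λ j → b j * r j ^ m)
        ≈⟨ +-cong (*-distribˡ-sum (ι q) (λ j → b j * r j ^ suc m))
                  (*-distribˡ-sum (- ι p) (λ j → b j * r j ^ m)) ⟩
      sum (λ j → ι q * (b j * r j ^ suc m)) + sum (λ j → - ι p * (b j * r j ^ m))
        ≈⟨ ∑-distrib-+ (λ j → ι q * (b j * r j ^ suc m)) (λ j → - ι p * (b j * r j ^ m)) ⟨
      sum (λ j → ι q * (b j * r j ^ suc m) + - ι p * (b j * r j ^ m))
        ≈⟨ sum-cong-≋ (λ j → solve 5
             (λ q p b r s → q :* (b :* (r :* s)) :+ p :* (b :* s) := b :* (q :* r :+ p) :* s)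
             refl (ι q) (- ι p) (b j) (r j) (r j ^ m)) ⟩
      sum (λ j → b j * (ι q * r j + - ι p) * r j ^ m)
        ∎

  -- The ratios are fractions `roots j / q` with a common denominator. Taking for `ps` all roots but
  -- the one at `i` makes `rootProduct ps` vanish at every other term. Only natural multiples of
  -- values of `h` are involved, which is what keeps the result a signed sum.
  annihilate-isolates : ∀ q {n} (roots : Fin (suc n) → ℕ) (i : Fin (suc n))
    (b r : Fin (suc n) → Carrier) {h} →
    (∀ j → ι q * r j ≈ ι (roots j)) →
    (∀ m → h m ≈ sum λ j → b j * r j ^ m) →
    let ps = tabulate (Vector.removeAt roots i) in
    annihilate q ps h ≈ b i * rootProduct ps (ι (roots i))
  annihilate-isolates q {n} roots i b r {h} qr≈root eq = begin
    annihilate q ps h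
      ≈⟨ annihilate-geometric q ps b r eq ⟩
    sum (λ j → b j * rootProduct ps (ι q * r j))
      ≈⟨ sum-cong-≋ (λ j → *-congˡ {b j} (rootProduct-cong ps (qr≈root j))) ⟩
    sum (λ j → b j * rootProduct ps (ι (roots j)))
      ≈⟨ sum-remove {i = i} (λ j → b j * rootProduct ps (ι (roots j))) ⟩
    b i * rootProduct ps (ι (roots i)) +
      sum (λ k → b (punchIn i k) * rootProduct ps (ι (roots (punchIn i k))))
      ≈⟨ +-congˡ (sum-cong-≋ {n} λ k → trans
           (*-congˡ {b (punchIn i k)} (rootProduct-root (∈-tabulate⁺ {f = Vector.removeAt roots i} k)))
           (zeroʳ _)) ⟩
    b i * rootProduct ps (ι (roots i)) + sum (Vector.replicate n 0#)
      ≈⟨ trans (+-congˡ (sum-replicate-zero n)) (+-identityʳ _) ⟩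
    b i * rootProduct ps (ι (roots i)) ∎
    where ps = tabulate (Vector.removeAt roots i)

  -- Signed sums with a fixed number of terms.

  -- The index is the exact number of terms, so that one `N` can serve all elements. The inductive
  -- form makes sums and negatives easy to build; `toSignedSum` converts it to functions on `Fin n`.
  data Combination {a} {A : Set a} (φ : A → Carrier) : ℕ → Carrier → Set (a ⊔ c ⊔ ℓ₁) where
    nil  : ∀ {x} → x ≈ 0# → Combination φ 0 x
    cons : ∀ {n x y} s a → Combination φ n y →
           x ≈ ⟦_⟧ˢ K s * φ a + y → Combination φ (suc n) x

  toSignedSum : ∀ {a} {A : Set a} {φ : A → Carrier} {n x} → Combination φ n x →
    Σ[ ε ∈ (Fin n → Sign) ] Σ[ as ∈ (Fin n → A) ] x ≈ signedSum K ε (φ ∘ as)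
  toSignedSum (nil x≈0) = (λ ()) , (λ ()) , x≈0
  toSignedSum (cons s a comb eq) =
    let ε , as , y≈ = toSignedSum comb
    in s Vector.∷ ε , a Vector.∷ as , trans eq (+-congˡ y≈)

  ⟦opposite⟧ˢ : ∀ s → ⟦_⟧ˢ K (opposite s) ≈ - ⟦_⟧ˢ K s
  ⟦opposite⟧ˢ Sign.+ = refl
  ⟦opposite⟧ˢ Sign.- = sym (-‿involutive 1#)

  -- Each factor replaces h(m) by q h(m + 1) - p h(m), hence `n` terms by `q * n + p * n`. The size
  -- does not depend on the sequence, which gives the uniform `N`.
  combinationSize : ℕ → ℕ → List ℕ → ℕ
  combinationSize n q []       = n
  combinationSize n q (p ∷ ps) = combinationSize (q ℕ.* n ℕ.+ p ℕ.* n) q ps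

  module _ {a : Level} {A : Set a} {φ : A → Carrier} where

    combination-resp : ∀ {n x y} → x ≈ y → Combination φ n x → Combination φ n y
    combination-resp x≈y (nil x≈0)         = nil (trans (sym x≈y) x≈0)
    combination-resp x≈y (cons s a comb eq) = cons s a comb (trans (sym x≈y) eq)

    combination-+ : ∀ {m n x y} → Combination φ m x → Combination φ n y →
                    Combination φ (m ℕ.+ n) (x + y)
    combination-+ (nil x≈0) comb =
      combination-resp (sym (trans (+-congʳ x≈0) (+-identityˡ _))) comb
    combination-+ (cons s a comb eq) comb′ =
      cons s a (combination-+ comb comb′) (trans (+-congʳ eq) (+-assoc _ _ _))

    combination-neg : ∀ {n x} → Combination φ n x → Combination φ n (- x)
    combination-neg (nil x≈0) = nil (trans (-‿cong x≈0) -0#≈0#)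
    combination-neg {x = x} (cons {y = y} s a comb eq) =
      cons (opposite s) a (combination-neg comb) (begin
        - x                                   ≈⟨ -‿cong eq ⟩
        - (⟦_⟧ˢ K s * φ a + y)                ≈⟨ -‿+-comm _ _ ⟨
        - (⟦_⟧ˢ K s * φ a) + - y              ≈⟨ +-congʳ (-‿distribˡ-* _ _) ⟩
        - ⟦_⟧ˢ K s * φ a + - y                ≈⟨ +-congʳ (*-congʳ (⟦opposite⟧ˢ s)) ⟨
        ⟦_⟧ˢ K (opposite s) * φ a + - y       ∎)

    combination-· : ∀ k {n x} → Combination φ n x → Combination φ (k ℕ.* n) (k · x)
    combination-· zero    comb = nil refl
    combination-· (suc k) comb = combination-+ comb (combination-· k comb)

    -- Each factor looks one place further, so only the values at `m ≤ length ps` enter. This finite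
    -- range matters when the points 2ᵐu + 1 have to be nonzero.
    combination-annihilate : ∀ {n} q ps {h} →
      (∀ m → m < suc (length ps) → Combination φ n (h m)) →
      Combination φ (combinationSize n q ps) (annihilate q ps h)
    combination-annihilate q []       comb = comb 0 (s≤s z≤n)
    combination-annihilate q (p ∷ ps) comb = combination-annihilate q ps λ m m≤ →
      combination-+ (combination-· q (comb (suc m) (s≤s m≤)))
                    (combination-neg (combination-· p (comb m (ℕ.m≤n⇒m≤1+n m≤))))

  -- Values and coefficients of Laurent polynomials.

  -- Factors `x * a′` cancel in pairs until one exponent is 0. Any inverse `a′` is allowed, because
  -- 2ᵐa comes with the explicit inverse ½ᵐa′.
  ^ℤ-⊖ : ∀ (a : Nonzero K) {a′} → proj₁ a * a′ ≈ 1# → ∀ m n →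
         _^ℤ_ K a (m ⊖ n) ≈ proj₁ a ^ m * a′ ^ n
  ^ℤ-⊖ a aa′≈1 zero    zero    = sym (*-identityʳ _)
  ^ℤ-⊖ a aa′≈1 (suc m) zero    = sym (*-identityʳ _)
  ^ℤ-⊖ a aa′≈1 zero    (suc n) = trans
    (^-congˡ (suc n) (inverse-unique (*-inverse a) aa′≈1)) (sym (*-identityˡ _))
  ^ℤ-⊖ a {a′} aa′≈1 (suc m) (suc n) = begin
    _^ℤ_ K a (suc m ⊖ suc n)        ≡⟨ ≡.cong (_^ℤ_ K a) (ℤ.[1+m]⊖[1+n]≡m⊖n m n) ⟩
    _^ℤ_ K a (m ⊖ n)                ≈⟨ ^ℤ-⊖ a aa′≈1 m n ⟩
    x ^ m * a′ ^ n                  ≈⟨ *-identityˡ _ ⟨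
    1# * (x ^ m * a′ ^ n)           ≈⟨ *-congʳ aa′≈1 ⟨
    x * a′ * (x ^ m * a′ ^ n)       ≈⟨ solve 4 (λ a b c d → a :* b :* (c :* d) := a :* c :* (b :* d))
                                              refl x a′ (x ^ m) (a′ ^ n) ⟩
    x ^ suc m * a′ ^ suc n          ∎
    where x = proj₁ a

  evalᴸ-expand : ∀ f (a : Nonzero K) {a′} → proj₁ a * a′ ≈ 1# →
    evalᴸ K f a ≈
    sum {suc (bound f ℕ.+ bound f)} λ j →
      coeff f (toℕ j ⊖ bound f) * (proj₁ a ^ toℕ j * a′ ^ bound f)
  evalᴸ-expand f a {a′} aa′≈1 = sum-cong-≋
    {suc (bound f ℕ.+ bound f)}
    {x = λ j → coeff f (toℕ j ⊖ bound f) * _^ℤ_ K a (toℕ j ⊖ bound f)}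
    {y = λ j → coeff f (toℕ j ⊖ bound f) * (proj₁ a ^ toℕ j * a′ ^ bound f)}
    λ j → *-congˡ (^ℤ-⊖ a aa′≈1 (toℕ j) (bound f))

  ^-^-comm : ∀ x m n → (x ^ m) ^ n ≈ (x ^ n) ^ m
  ^-^-comm x m n = begin
    (x ^ m) ^ n    ≈⟨ ^-assocʳ x m n ⟩
    x ^ (m ℕ.* n)  ≡⟨ ≡.cong (x ^_) (ℕ.*-comm m n) ⟩
    x ^ (n ℕ.* m)  ≈⟨ ^-assocʳ x n m ⟨
    (x ^ n) ^ m    ∎

  -- The product is the power of `x` with integer exponent m - n. Choosing `x` as `a` if n < m, and
  -- as the inverse of `a` if m < n, makes the exponent of `a` positive.
  nonzero-exponent : ∀ {m n} → m ≢ n → Σ[ d ∈ ℕ ] (∀ {a} → a # 0# →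
    Σ[ x ∈ Carrier ] Σ[ x′ ∈ Carrier ] x * x′ ≈ 1# × x ^ m * x′ ^ n ≈ a ^ suc d)
  nonzero-exponent {m} {n} m≢n with ℕ.<-cmp m n
  ... | tri≈ _ m≡n _ = contradiction m≡n m≢n
  ... | tri> _ _ n<m with ℕ.m≤n⇒∃[o]m+o≡n n<m
  ...   | d , ≡.refl = d , λ {a} a#0 →
    let aa′≈1 = *-inverse (a , a#0) in
    a , inverse K (a , a#0) , aa′≈1 ,
    trans (*-congʳ (reflexive (≡.cong (a ^_) (≡.sym (ℕ.+-suc n d)))))
          (^-cancel n (suc d) aa′≈1)
  nonzero-exponent {m} {n} m≢n | tri< m<n _ _ with ℕ.m≤n⇒∃[o]m+o≡n m<n
  ...   | d , ≡.refl = d , λ {a} a#0 →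
    let aa′≈1 = *-inverse (a , a#0) in
    inverse K (a , a#0) , a , trans (*-comm _ _) aa′≈1 ,
    trans (*-comm _ _)
      (trans (*-congʳ (reflexive (≡.cong (a ^_) (≡.sym (ℕ.+-suc m d)))))
             (^-cancel m (suc d) aa′≈1))

  -- `f` is compared with the constant given by its own constant term, so they cannot differ at
  -- exponent 0. The exponent where they differ lies within the bound, as `f` vanishes beyond it.
  nonconstant-term : ∀ f → NonConstant K f →
    Σ[ i ∈ Fin (suc (bound f ℕ.+ bound f)) ]
      toℕ i ≢ bound f × coeff f (toℕ i ⊖ bound f) # 0#
  nonconstant-term f nonConstant with nonConstant (coeff f (+ 0))
  ... | + zero , c#c = contradiction c#c (#-irrefl refl)
  ... | + suc n , c#0 with bound f ℕ.<? suc n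
  ...   | yes B<1+n = contradiction c#0 (#-irrefl (support f (+ suc n) B<1+n))
  -- Exponent k has index `bound f` + k in the sum.
  ...   | no B≮1+n = fromℕ< i<1+B+B , i≢B ∘ ≡.trans (≡.sym toℕ-i) ,
    ≡.subst (λ k → coeff f k # 0#)
      (≡.sym (≡.trans (≡.cong (_⊖ bound f) toℕ-i) (+-⊖ (bound f) (suc n)))) c#0
    where
    i<1+B+B : bound f ℕ.+ suc n < suc (bound f ℕ.+ bound f)
    i<1+B+B = s≤s (ℕ.+-monoʳ-≤ (bound f) (ℕ.≮⇒≥ B≮1+n))
    toℕ-i = toℕ-fromℕ< i<1+B+B
    i≢B : bound f ℕ.+ suc n ≢ bound f
    i≢B = ℕ.m+1+n≢m (bound f)
    +-⊖ : ∀ m n → m ℕ.+ n ⊖ m ≡ + n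
    +-⊖ m n = ≡.trans (ℤ.⊖-≥ (ℕ.m≤m+n m n)) (≡.cong +_ (ℕ.m+n∸m≡n m n))
  nonconstant-term f nonConstant | -[1+ n ] , c#0 with bound f ℕ.<? suc n
  ...   | yes B<1+n = contradiction c#0 (#-irrefl (support f -[1+ n ] B<1+n))
  ...   | no B≮1+n = fromℕ< i<1+B+B , i≢B ∘ ≡.trans (≡.sym toℕ-i) ,
    ≡.subst (λ k → coeff f k # 0#) (≡.sym i⊖B) c#0
    where
    1+n≤B = ℕ.≮⇒≥ B≮1+n
    -- The truncated subtraction is exact here, by `1+n≤B`.
    i<B : bound f ∸ suc n < bound f
    i<B = ℕ.∸-monoʳ-< {bound f} {suc n} {0} (s≤s z≤n) 1+n≤B
    i<1+B+B : bound f ∸ suc n < suc (bound f ℕ.+ bound f)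
    i<1+B+B = ℕ.m≤n⇒m≤1+n (ℕ.≤-trans i<B (ℕ.m≤m+n (bound f) (bound f)))
    toℕ-i = toℕ-fromℕ< i<1+B+B
    i≢B = ℕ.<⇒≢ i<B
    i⊖B : toℕ (fromℕ< i<1+B+B) ⊖ bound f ≡ -[1+ n ]
    i⊖B = ≡.trans (≡.cong (_⊖ bound f) toℕ-i)
      (≡.trans (ℤ.⊖-< i<B) (≡.cong (λ k → ℤ.- (+ k)) (ℕ.m∸[m∸n]≡n 1+n≤B)))

  -- Natural numbers in characteristic 0.

  module _ (char0 : CharacteristicZero K) where

    ι#0 : ∀ {n} → 0 < n → ι n # 0#
    ι#0 {suc n} _ = char0 n

    ι-apart-smaller : ∀ {m n} → n < m → ι m + - ι n # 0#
    ι-apart-smaller {m} {n} n<m with ℕ.m≤n⇒∃[o]m+o≡n n<m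
    ... | k , ≡.refl = #-congʳ (sym (begin
      ι (suc n ℕ.+ k) - ι n       ≡⟨ ≡.cong (λ l → ι l - ι n) (≡.cong suc (ℕ.+-comm n k)) ⟩
      ι (suc k ℕ.+ n) - ι n       ≈⟨ +-congʳ (×-homo-+ 1# (suc k) n) ⟩
      ι (suc k) + ι n - ι n       ≈⟨ +-assoc _ _ _ ⟩
      ι (suc k) + (ι n - ι n)     ≈⟨ +-congˡ (-‿inverseʳ (ι n)) ⟩
      ι (suc k) + 0#              ≈⟨ +-identityʳ _ ⟩
      ι (suc k)                   ∎)) (char0 k)

    ι-apart : ∀ {m n} → m ≢ n → ι m + - ι n # 0#
    ι-apart {m} {n} m≢n with ℕ.<-cmp m n
    ... | tri≈ _ m≡n _ = contradiction m≡n m≢n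
    ... | tri> _ _ n<m = ι-apart-smaller n<m
    ... | tri< m<n _ _ = *#0⇒#0ʳ {x = - 1#} (#-congʳ (begin
        ι n - ι m             ≈⟨ ⁻¹-anti-homo‿- (ι m) (ι n) ⟨
        - (ι m - ι n)         ≈⟨ -1*x≈-x _ ⟨
        - 1# * (ι m - ι n)    ∎) (ι-apart-smaller m<n))

    rootProduct#0 : ∀ {n ps} → All (n ≢_) ps → rootProduct ps (ι n) # 0#
    rootProduct#0 []           = 1#0
    rootProduct#0 (n≢p ∷ n≢ps) = x#0y#0→xy#0 (ι-apart n≢p) (rootProduct#0 n≢ps)

    -- The isolated term survives: distinct natural numbers stay apart in characteristic 0, and a
    -- product of nonzero factors is nonzero.
    otherRootProduct#0 : ∀ {n} {roots : Fin (suc n) → ℕ} →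
      (∀ {i j} → roots i ≡ roots j → i ≡ j) → ∀ i →
      rootProduct (tabulate (Vector.removeAt roots i)) (ι (roots i)) # 0#
    otherRootProduct#0 injective i = rootProduct#0 (All.tabulate⁺ λ k eq →
      punchInᵢ≢i i k (≡.sym (injective eq)))

    2^toℕ-injective : ∀ {n} {i j : Fin n} → 2 ℕ.^ toℕ i ≡ 2 ℕ.^ toℕ j → i ≡ j
    2^toℕ-injective = toℕ-injective ∘ 2^-injective

    ½ : Carrier
    ½ = inverse K (ι 2 , char0 1)

    2*½≈1 : ι 2 * ½ ≈ 1#
    2*½≈1 = *-inverse (ι 2 , char0 1)

    -- From values of `f` to a single power.

    -- Along the points 2ᵐa the term of index `j` is geometric in m with ratio 2 to the power j - B,
    -- where B is `bound f`. These ratios are distinct, so one term can be isolated. Neither `n` nor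
    -- `κ` depends on `a`.
    monomial-combination : ∀ f (i : Fin (suc (bound f ℕ.+ bound f))) →
      coeff f (toℕ i ⊖ bound f) # 0# →
      Σ[ n ∈ ℕ ] Σ[ κ ∈ Carrier ] κ # 0# × (∀ {a a′} → a * a′ ≈ 1# →
        Combination (evalᴸ K f) n (κ * (a ^ toℕ i * a′ ^ bound f)))
    monomial-combination f i fᵢ#0 =
      combinationSize 1 q ps , coeff f (toℕ i ⊖ B) * P ,
      x#0y#0→xy#0 fᵢ#0 (otherRootProduct#0 {roots = roots} 2^toℕ-injective i) , combine
      where
      B = bound f
      -- Clears the denominators of the ratios and leaves the roots 2ʲ.
      q = 2 ℕ.^ B
      roots : Fin (suc (B ℕ.+ B)) → ℕ
      roots j = 2 ℕ.^ toℕ j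
      ps = tabulate (Vector.removeAt roots i)
      P = rootProduct ps (ι (roots i))
      r : Fin (suc (B ℕ.+ B)) → Carrier
      r j = ι 2 ^ toℕ j * ½ ^ B

      qr≈root : ∀ j → ι q * r j ≈ ι (roots j)
      qr≈root j = begin
        ι q * (ι 2 ^ toℕ j * ½ ^ B)      ≈⟨ *-congʳ (ι-^ 2 B) ⟩
        ι 2 ^ B * (ι 2 ^ toℕ j * ½ ^ B)  ≈⟨ solve 3 (λ x y z → x :* (y :* z) := x :* z :* y)
                                              refl (ι 2 ^ B) (ι 2 ^ toℕ j) (½ ^ B) ⟩
        ι 2 ^ B * ½ ^ B * ι 2 ^ toℕ j    ≈⟨ *-congʳ (inverse-^ B 2*½≈1) ⟩
        1# * ι 2 ^ toℕ j                 ≈⟨ *-identityˡ _ ⟩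
        ι 2 ^ toℕ j                      ≈⟨ ι-^ 2 (toℕ j) ⟨
        ι (roots j)                      ∎

      combine : ∀ {a a′} → a * a′ ≈ 1# →
        Combination (evalᴸ K f) (combinationSize 1 q ps)
          (coeff f (toℕ i ⊖ B) * P * (a ^ toℕ i * a′ ^ B))
      combine {a} {a′} aa′≈1 = combination-resp
        (trans (annihilate-isolates q roots i b r qr≈root expand)
               (solve 3 (λ x y z → x :* y :* z := x :* z :* y) refl
                 (coeff f (toℕ i ⊖ B)) (a ^ toℕ i * a′ ^ B) P))
        (combination-annihilate q ps λ m _ → cons Sign.+ (point m) (nil refl)
          (sym (trans (+-identityʳ _) (*-identityˡ _))))
        where
        b : Fin (suc (B ℕ.+ B)) → Carrier
        b j = coeff f (toℕ j ⊖ B) * (a ^ toℕ j * a′ ^ B)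

        point-inverse : ∀ m → (ι 2 ^ m * a) * (½ ^ m * a′) ≈ 1#
        point-inverse m = inverse-* (inverse-^ m 2*½≈1) aa′≈1

        point : ℕ → Nonzero K
        point m = ι 2 ^ m * a , unit⇒#0 (point-inverse m)

        expand : ∀ m → evalᴸ K f (point m) ≈ sum λ j → b j * r j ^ m
        expand m = trans (evalᴸ-expand f (point m) (point-inverse m))
          (sum-cong-≋ {suc (B ℕ.+ B)}
                      {x = λ j → coeff f (toℕ j ⊖ B) *
                         ((ι 2 ^ m * a) ^ toℕ j * (½ ^ m * a′) ^ B)}
                      {y = λ j → b j * r j ^ m} λ j → begin
            coeff f (toℕ j ⊖ B) * ((ι 2 ^ m * a) ^ toℕ j * (½ ^ m * a′) ^ B)
              ≈⟨ *-congˡ (*-cong (powers (ι 2) a (toℕ j)) (powers ½ a′ B)) ⟩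
            coeff f (toℕ j ⊖ B) *
              ((ι 2 ^ toℕ j) ^ m * a ^ toℕ j * ((½ ^ B) ^ m * a′ ^ B))
              ≈⟨ solve 5 (λ c x y z w → c :* (x :* y :* (z :* w)) := c :* (y :* w) :* (x :* z))
                   refl (coeff f (toℕ j ⊖ B)) ((ι 2 ^ toℕ j) ^ m) (a ^ toℕ j)
                   ((½ ^ B) ^ m) (a′ ^ B) ⟩
            b j * ((ι 2 ^ toℕ j) ^ m * (½ ^ B) ^ m)
              ≈⟨ *-congˡ (^-distrib-* (ι 2 ^ toℕ j) (½ ^ B) m) ⟨
            b j * r j ^ m ∎)
          where
          powers : ∀ x y k → (x ^ m * y) ^ k ≈ (x ^ k) ^ m * y ^ k
          powers x y k = trans (^-distrib-* (x ^ m) y k) (*-congʳ (^-^-comm x m k))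

    power-combination : ∀ f → NonConstant K f →
      Σ[ d ∈ ℕ ] Σ[ n ∈ ℕ ] Σ[ κ ∈ Carrier ] κ # 0# × (∀ {a} → a # 0# →
        Combination (evalᴸ K f) n (κ * a ^ suc d))
    power-combination f nonConstant =
      let i , i≢B , fᵢ#0 = nonconstant-term f nonConstant
          n , κ , κ#0 , comb = monomial-combination f i fᵢ#0
          d , power = nonzero-exponent i≢B
      in d , n , κ , κ#0 , λ a#0 →
         let x , x′ , xx′≈1 , eq = power a#0
         in combination-resp (*-congˡ eq) (comb xx′≈1)

    -- 2ᵐu + 1 and 2ⁿ(- u) + 1 cannot both vanish, as 2ⁿ + 2ᵐ is a positive
    -- combination of them.
    doublings#-1 : ∀ n u →
      (∀ m → m < n → ι 2 ^ m * u + 1# # 0#) ⊎ (∀ m → m < n → ι 2 ^ m * - u + 1# # 0#)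
    doublings#-1 n u =
      -- For fixed `m`, the inner search gives either apartness for `u` at all exponents or
      -- apartness for `- u` at `m`. The outer search then runs over `m`.
      swap (∀<-⊎ (λ m → swap (∀<-⊎ (λ m′ → split m′ m) n)) n)
      where
      split : ∀ m n → ι 2 ^ m * u + 1# # 0# ⊎ ι 2 ^ n * - u + 1# # 0#
      split m n = Sum.map *#0⇒#0ʳ *#0⇒#0ʳ (+#0⇒#0⊎#0
        (#-congʳ (sym sum≈) (ι#0 (ℕ.m≤n⇒m≤n+o (2 ℕ.^ m) (ℕ.m^n>0 2 n)))))
        where
        sum≈ : ι 2 ^ n * (ι 2 ^ m * u + 1#) + ι 2 ^ m * (ι 2 ^ n * - u + 1#) ≈
               ι (2 ℕ.^ n ℕ.+ 2 ℕ.^ m)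
        sum≈ = begin
          ι 2 ^ n * (ι 2 ^ m * u + 1#) + ι 2 ^ m * (ι 2 ^ n * - u + 1#)
            ≈⟨ solve 4 (λ x y u v → x :* (y :* u :+ con 1) :+ y :* (x :* v :+ con 1) :=
                                    x :* y :* (u :+ v) :+ (x :+ y))
                 refl (ι 2 ^ n) (ι 2 ^ m) u (- u) ⟩
          ι 2 ^ n * ι 2 ^ m * (u - u) + (ι 2 ^ n + ι 2 ^ m)
            ≈⟨ +-congʳ (trans (*-congˡ (-‿inverseʳ u)) (zeroʳ _)) ⟩
          0# + (ι 2 ^ n + ι 2 ^ m)
            ≈⟨ +-identityˡ _ ⟩
          ι 2 ^ n + ι 2 ^ m
            ≈⟨ +-cong (ι-^ 2 n) (ι-^ 2 m) ⟨
          ι (2 ℕ.^ n) + ι (2 ℕ.^ m)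
            ≈⟨ ×-homo-+ 1# (2 ℕ.^ n) (2 ℕ.^ m) ⟨
          ι (2 ℕ.^ n ℕ.+ 2 ℕ.^ m) ∎

    -- From a power to all elements.

    -- In the binomial expansion of (2ᵐu + 1) to the power d + 1, the term in uʲ has ratio 2ʲ, a
    -- natural number, so `q` is 1. The term with j = 1 has binomial coefficient d + 1, which is
    -- nonzero in characteristic 0.
    linear-combination : ∀ {a} {A : Set a} {φ : A → Carrier} d {n κ} → κ # 0# →
      (∀ {a} → a # 0# → Combination φ n (κ * a ^ suc d)) →
      Σ[ n ∈ ℕ ] Σ[ κ ∈ Carrier ] κ # 0# × (∀ u → Combination φ n (κ * u))
    linear-combination {φ = φ} d {n} {κ} κ#0 comb =
      combinationSize n 1 ps , κ * ι (suc d) * P ,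
      x#0y#0→xy#0 (x#0y#0→xy#0 κ#0 (char0 d))
        (otherRootProduct#0 {roots = roots} 2^toℕ-injective i) , combine
      where
      i : Fin (suc (suc d))
      -- The index of the term linear in `u`.
      i = suc zero
      roots : Fin (suc (suc d)) → ℕ
      roots j = 2 ℕ.^ toℕ j
      ps = tabulate (Vector.removeAt roots i)
      P = rootProduct ps (ι (roots i))
      r : Fin (suc (suc d)) → Carrier
      r j = ι 2 ^ toℕ j

      r≈root : ∀ j → ι 1 * r j ≈ ι (roots j)
      r≈root j = begin
        ι 1 * ι 2 ^ toℕ j   ≈⟨ *-congʳ (×-homo-1 1#) ⟩
        1# * ι 2 ^ toℕ j    ≈⟨ *-identityˡ _ ⟩
        ι 2 ^ toℕ j         ≈⟨ ι-^ 2 (toℕ j) ⟨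
        ι (roots j)         ∎

      combine-apart : ∀ u → (∀ m → m < suc (length ps) → ι 2 ^ m * u + 1# # 0#) →
        Combination φ (combinationSize n 1 ps) (κ * ι (suc d) * P * u)
      combine-apart u apart = combination-resp
        (begin
          annihilate 1 ps h
            ≈⟨ annihilate-isolates 1 roots i b r r≈root expand ⟩
          κ * ((suc d C 1) · (u * 1#)) * P
            ≈⟨ *-congʳ (*-congˡ (trans (·-ι (suc d C 1) (u * 1#)) (*-congˡ (*-identityʳ u)))) ⟩
          κ * (ι (suc d C 1) * u) * P
            ≡⟨ ≡.cong (λ k → κ * (ι k * u) * P) (nC1≡n (suc d)) ⟩
          κ * (ι (suc d) * u) * P
            ≈⟨ solve 4 (λ c k u p → c :* (k :* u) :* p := c :* k :* p :* u)
                 refl κ (ι (suc d)) u P ⟩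
          κ * ι (suc d) * P * u ∎)
        (combination-annihilate 1 ps λ m m≤ → comb (apart m m≤))
        where
        h : ℕ → Carrier
        h m = κ * (ι 2 ^ m * u + 1#) ^ suc d

        b : Fin (suc (suc d)) → Carrier
        b j = κ * ((suc d C toℕ j) · u ^ toℕ j)

        expand : ∀ m → h m ≈ sum λ j → b j * r j ^ m
        expand m = begin
          κ * (ι 2 ^ m * u + 1#) ^ suc d
            ≈⟨ *-congˡ (Binomial.theorem commutativeSemiring (suc d) (ι 2 ^ m * u) 1#) ⟩
          κ * sum term
            ≈⟨ *-distribˡ-sum κ term ⟩
          sum (λ j → κ * term j)
            ≈⟨ sum-cong-≋ {x = λ j → κ * term j} {y = λ j → b j * r j ^ m} expandTerm ⟩
          sum (λ j → b j * r j ^ m) ∎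
          where
          term : Fin (suc (suc d)) → Carrier
          term j = (suc d C toℕ j) · ((ι 2 ^ m * u) ^ toℕ j * 1# ^ (suc d ∸ toℕ j))

          expandTerm : ∀ j → κ * term j ≈ b j * r j ^ m
          expandTerm j = begin
            κ * (k · ((ι 2 ^ m * u) ^ toℕ j * 1# ^ (suc d ∸ toℕ j)))
              ≈⟨ *-congˡ (×-congʳ k (trans (*-congˡ (1^n≈1 (suc d ∸ toℕ j))) (*-identityʳ _))) ⟩
            κ * (k · (ι 2 ^ m * u) ^ toℕ j)
              ≈⟨ *-congˡ (×-congʳ k (^-distrib-* (ι 2 ^ m) u (toℕ j))) ⟩
            κ * (k · ((ι 2 ^ m) ^ toℕ j * u ^ toℕ j))
              ≈⟨ *-congˡ (×-congʳ k (*-congʳ (^-^-comm (ι 2) m (toℕ j)))) ⟩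
            κ * (k · (r j ^ m * u ^ toℕ j))
              ≈⟨ *-congˡ (×-congʳ k (*-comm _ _)) ⟩
            κ * (k · (u ^ toℕ j * r j ^ m))
              ≈⟨ *-congˡ (×-assoc-* k _ _) ⟨
            κ * (k · u ^ toℕ j * r j ^ m)
              ≈⟨ *-assoc _ _ _ ⟨
            b j * r j ^ m ∎
            where k = suc d C toℕ j

      combine : ∀ u →
        Combination φ (combinationSize n 1 ps) (κ * ι (suc d) * P * u)
      combine u = Sum.[ combine-apart u , combine-apart-neg ]′
                       (doublings#-1 (suc (length ps)) u)
        where
        combine-apart-neg : (∀ m → m < suc (length ps) → ι 2 ^ m * - u + 1# # 0#) →
          Combination φ (combinationSize n 1 ps) (κ * ι (suc d) * P * u)
        -- The target is odd in `u`: reversing all signs in a representation for `- u` gives one for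
        -- `u` with the same number of terms.
        combine-apart-neg apart = combination-resp
          (trans (-‿distribʳ-* _ _) (*-congˡ (-‿involutive u)))
          (combination-neg (combine-apart (- u) apart))

    all-combination : ∀ {a} {A : Set a} {φ : A → Carrier} {n κ} → κ # 0# →
      (∀ u → Combination φ n (κ * u)) → ∀ x → Combination φ n x
    all-combination {κ = κ} κ#0 comb x = combination-resp (begin
      κ * (κ⁻¹ * x)   ≈⟨ *-assoc _ _ _ ⟨
      κ * κ⁻¹ * x     ≈⟨ *-congʳ (*-inverse (κ , κ#0)) ⟩
      1# * x          ≈⟨ *-identityˡ x ⟩
      x               ∎) (comb (κ⁻¹ * x))
      where κ⁻¹ = inverse K (κ , κ#0)

    waring : ∀ f → NonConstant K f →
      Σ[ N ∈ ℕ ] (1 ≤ N × (∀ (x : Carrier) →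
        Σ[ ε ∈ (Fin N → Sign) ] Σ[ a ∈ (Fin N → Nonzero K) ]
          x ≈ signedSum K ε (λ i → evalᴸ K f (a i))))
    waring f nonConstant =
      let d , _ , _ , κ#0 , comb = power-combination f nonConstant
          N , κ′ , κ′#0 , comb′ = linear-combination d κ#0 comb
          every = all-combination κ′#0 comb′
      in N , positive (every 1#) , toSignedSum ∘ every
      where
      -- An empty sum is 0, so representing `1#` takes at least one term.
      positive : ∀ {n} → Combination (evalᴸ K f) n 1# → 1 ≤ n
      positive (nil 1≈0)      = contradiction 1#0 (#-irrefl 1≈0)
      positive (cons _ _ _ _) = s≤s z≤n

  -- Laurent polynomials as rational functions.

  evalᴾ-tabulate : ∀ {n} (b : Fin n → Carrier) a →
    evalᴾ K (tabulate b) a ≈ sum λ j → b j * a ^ toℕ j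
  evalᴾ-tabulate {zero}  b a = refl
  evalᴾ-tabulate {suc n} b a = +-cong (sym (*-identityʳ _)) (begin
    a * evalᴾ K (tabulate (b ∘ suc)) a
      ≈⟨ *-congˡ (evalᴾ-tabulate (b ∘ suc) a) ⟩
    a * sum (λ j → b (suc j) * a ^ toℕ j)
      ≈⟨ *-distribˡ-sum a (λ j → b (suc j) * a ^ toℕ j) ⟩
    sum (λ j → a * (b (suc j) * a ^ toℕ j))
      ≈⟨ sum-cong-≋ {n} (λ j → solve 3 (λ a b c → a :* (b :* c) := b :* (a :* c))
           refl a (b (suc j)) (a ^ toℕ j)) ⟩
    sum (λ j → b (suc j) * a ^ toℕ (suc j)) ∎)

  evalᴾ-monomial : ∀ n a → evalᴾ K (monomial K n) a ≈ a ^ n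
  evalᴾ-monomial zero    a = trans (+-congˡ (zeroʳ a)) (+-identityʳ 1#)
  evalᴾ-monomial (suc n) a = trans (+-identityˡ _) (*-congˡ (evalᴾ-monomial n a))

  -- The given fraction is its own witness: its denominator at `a` is a power of `a`, hence
  -- invertible.
  notPole : ∀ f ((a , _) : Nonzero K) → NotPole K (toRationalFunction K f) a
  notPole f a = toRationalFunction K f , (λ _ → refl) ,
    #-congʳ (sym (evalᴾ-monomial (bound f) (proj₁ a)))
            (unit⇒#0 (inverse-^ (bound f) (*-inverse a)))

  -- `inverse` depends on a proof of apartness, so the inverse of the denominator is identified with
  -- a power of `inverse K a` by uniqueness of inverses.
  value-toRationalFunction : ∀ f a →
    value K (toRationalFunction K f) (proj₁ a) (notPole f a) ≈ evalᴸ K f a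
  value-toRationalFunction f a = begin
    evalᴾ K (tabulate b) x * inverse K den
      ≈⟨ *-cong (evalᴾ-tabulate b x) (inverse-unique (*-inverse den)
           (trans (*-congʳ (evalᴾ-monomial B x)) (inverse-^ B (*-inverse a)))) ⟩
    sum (λ j → b j * x ^ toℕ j) * x⁻¹ ^ B
      ≈⟨ *-distribʳ-sum (x⁻¹ ^ B) (λ j → b j * x ^ toℕ j) ⟩
    sum (λ j → b j * x ^ toℕ j * x⁻¹ ^ B)
      ≈⟨ sum-cong-≋ {x = λ j → b j * x ^ toℕ j * x⁻¹ ^ B}
                    {y = λ j → b j * (x ^ toℕ j * x⁻¹ ^ B)} (λ j → *-assoc _ _ _) ⟩
    sum (λ j → b j * (x ^ toℕ j * x⁻¹ ^ B))
      ≈⟨ evalᴸ-expand f a (*-inverse a) ⟨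
    evalᴸ K f a ∎
    where
    B = bound f
    x = proj₁ a
    x⁻¹ = inverse K a
    den = evalᴾ K (monomial K B) x , proj₂ (proj₂ (notPole f a))
    b : Fin (suc (B ℕ.+ B)) → Carrier
    b j = coeff f (toℕ j ⊖ B)

  signedSum-cong : ∀ {n} (ε : Fin n → Sign) {v w : Fin n → Carrier} →
    (∀ i → v i ≈ w i) → signedSum K ε v ≈ signedSum K ε w
  signedSum-cong {n} ε v≈w = sum-cong-≋ {n} λ i → *-congˡ {⟦_⟧ˢ K (ε i)} (v≈w i)

-- The rational numbers.

-- Apartness in ℚ is the negation of `≡`, and the order refutes the equation: 1 plus a nonnegative
-- number is positive.
ℚ-characteristicZero : CharacteristicZero ℚ-field
ℚ-characteristicZero n eq =
  ℚ.<⇒≢ (ℚ.positive⁻¹ _ {{1+n-positive}}) (≡.sym eq)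
  where
  n-nonNegative : ∀ n → NonNegative (ι ℚ-field n)
  n-nonNegative zero    = _
  n-nonNegative (suc n) = ℚ.nonNeg+nonNeg⇒nonNeg 1ℚ (ι ℚ-field n) {{n-nonNegative n}}

  1+n-positive : Positive (ι ℚ-field (suc n))
  1+n-positive = ℚ.pos+nonNeg⇒pos 1ℚ (ι ℚ-field n) {{n-nonNegative n}}

theorem3p1 : ∀ {c ℓ₁ ℓ₂} →
    ((K : HeytingField c ℓ₁ ℓ₂) → CharacteristicZero K →
    (f : LaurentPolynomial K) → NonConstant K f →
    let open HeytingField K in
    Σ[ N ∈ ℕ ] (1 ≤ N × (∀ (x : Carrier) →
    Σ[ ε ∈ (Fin N → Sign) ] Σ[ a ∈ (Fin N → Nonzero K) ]
    x ≈ signedSum K ε (λ i → evalᴸ K f (a i)))))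
    ×
    ((f : LaurentPolynomial ℚ-field) → NonConstant ℚ-field f →
    EWP (toRationalFunction ℚ-field f))
theorem3p1 = waring , λ f nonConstant →
  let N , 1≤N , represent = waring ℚ-field ℚ-characteristicZero f nonConstant in
  N , 1≤N , λ x →
    let ε , a , x≡ = represent x in
    ε , proj₁ ∘ a , notPole ℚ-field f ∘ a ,
    ≡.trans x≡ (≡.sym (signedSum-cong ℚ-field ε (value-toRationalFunction ℚ-field f ∘ a)))
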